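{- Let $f,g,h:\{0,1\}^n\to\{0,1\}$ be such that $f=g\vee h$. Let $g_\ell,g_u:\{0,1\}^n\to\{0,1\}$ be $\varepsilon$-sandwiching approximators for $g$. Then $g_\ell\vee h$ and $g_u\vee h$ are $\varepsilon$-sandwiching approximators for $f$.
   Context: Functions $f_\ell,f_u:\{0,1\}^n\to\{0,1\}$ are $\varepsilon$-sandwiching approximators for $f:\{0,1\}^n\to\{0,1\}$ if $f_\ell(x)\le f(x)\le f_u(x)$ for every $x\in\{0,1\}^n$, and $\Pr_x[f_\ell(x)\ne f(x)]\le\varepsilon$ and $\Pr_x[f_u(x)\ne f(x)]\le\varepsilon$ for $x$ uniform in $\{0,1\}^n$. Here $\vee$ is pointwise OR. -}

module Defs where

open import Data.Bool using (Bool; true; false; _∨_)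
import Data.Bool as Bool
open import Data.Integer using (+_)
open import Data.List using (List; []; _∷_; length; filter; cartesianProductWith)
open import Data.Nat using (ℕ; zero; suc; _^_)
open import Data.Nat.Properties using (m^n≢0)
open import Data.Product using (∃; _×_; _,_)
open import Data.Rational using (ℚ; _<_; _/_; _+_; 0ℚ; 1ℚ; -_)
open import Data.Rational.Properties
  using (<-trans; <-asym; <-dense; <-cmp; +-monoʳ-<; +-identityʳ; positive⁻¹; negative⁻¹)
open import Data.Sum using (_⊎_; inj₁; inj₂)
open import Data.Vec using (Vec; []; _∷_)
open import Function using (_⇔_; mk⇔)
open import Relation.Binary using (tri<; tri≈; tri>)
open import Relation.Binary.PropositionalEquality using (refl; subst)
open import Relation.Nullary using (¬_; ¬?)
open import Relation.Unary using (Pred; Decidable)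

-- Two-sided (located) Dedekind cuts of ℚ, since the library has no real numbers.
record ℝ : Set₁ where
  field
    L U         : ℚ → Set
    L-inhabited : ∃ L
    U-inhabited : ∃ U
    L-rounded   : ∀ p → L p ⇔ ∃ λ q → p < q × L q
    U-rounded   : ∀ q → U q ⇔ ∃ λ p → p < q × U p
    disjoint    : ∀ q → ¬ (L q × U q)
    located     : ∀ p q → p < q → L p ⊎ U q

infix 4 _≤ℝ_
_≤ℝ_ : ℝ → ℝ → Set
x ≤ℝ y = ∀ q → ℝ.L x q → ℝ.L y q

fromℚ : ℚ → ℝ
fromℚ r = record
  { L = _< r
  ; U = r <_
  ; L-inhabited = r + - 1ℚ , subst (r + - 1ℚ <_) (+-identityʳ r) (+-monoʳ-< r (negative⁻¹ (- 1ℚ)))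
  ; U-inhabited = r + 1ℚ , subst (_< r + 1ℚ) (+-identityʳ r) (+-monoʳ-< r (positive⁻¹ 1ℚ))
  ; L-rounded = λ p → mk⇔ <-dense (λ (_ , p<q , q<r) → <-trans p<q q<r)
  ; U-rounded = λ q → mk⇔ (λ r<q → let (p , r<p , p<q) = <-dense r<q in p , p<q , r<p)
                          (λ (_ , p<q , r<p) → <-trans r<p p<q)
  ; disjoint = λ q (q<r , r<q) → <-asym q<r r<q
  ; located = located
  }
  where
  located : ∀ p q → p < q → p < r ⊎ r < q
  located p q p<q with <-cmp p r
  ... | tri< p<r _ _    = inj₁ p<r
  ... | tri≈ _ refl _   = inj₂ p<q
  ... | tri> _ _ r<p    = inj₂ (<-trans r<p p<q)

BoolFun : ℕ → Set
BoolFun n = Vec Bool n → Bool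

infixr 5 _∨ᶠ_
_∨ᶠ_ : ∀ {n} → BoolFun n → BoolFun n → BoolFun n
(g ∨ᶠ h) x = g x ∨ h x

-- Every element of {0,1}ⁿ, each exactly once.
cube : ∀ n → List (Vec Bool n)
cube zero    = [] ∷ []
cube (suc n) = cartesianProductWith _∷_ (false ∷ true ∷ []) (cube n)

-- The probability of P under the uniform distribution on {0,1}ⁿ.
Pr : ∀ {n ℓ} {P : Pred (Vec Bool n) ℓ} → Decidable P → ℚ
Pr {n} P? = + length (filter P? (cube n)) / 2 ^ n
  where instance _ = m^n≢0 2 n

Pr[_≢_] : ∀ {n} → BoolFun n → BoolFun n → ℚ
Pr[ f ≢ g ] = Pr λ x → ¬? (f x Bool.≟ g x)

record Sandwiching {n : ℕ} (ε : ℝ) (fℓ fᵤ f : BoolFun n) : Set where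
  field
    lower       : ∀ x → fℓ x Bool.≤ f x
    upper       : ∀ x → f x Bool.≤ fᵤ x
    lower-error : fromℚ Pr[ fℓ ≢ f ] ≤ℝ ε
    upper-error : fromℚ Pr[ fᵤ ≢ f ] ≤ℝ ε

{-# OPTIONS --safe #-}
module Submission where

open import Defs
open import Data.Bool using (Bool; _∨_)
import Data.Bool as Bool
import Data.Bool.Properties as Bool
open import Data.Integer as ℤ using (ℤ; +_)
import Data.Integer.Properties as ℤ
open import Data.List.Relation.Binary.Sublist.Propositional using (⊆-refl)
open import Data.List.Relation.Binary.Sublist.Propositional.Properties
  using (filter⁺; length-mono-≤)
open import Data.Nat using (ℕ; suc; _^_; NonZero)
open import Data.Nat.Properties using (m^n≢0)
open import Data.Rational using (_≤_; _/_; toℚᵘ)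
open import Data.Rational.Properties using (toℚᵘ-cancel-≤; toℚᵘ-fromℚᵘ; <-≤-trans)
open import Data.Rational.Unnormalised using (mkℚᵘ; *≤*)
import Data.Rational.Unnormalised.Properties as ℚᵘ
open import Data.Vec using (Vec)
open import Relation.Binary.PropositionalEquality using (_≗_; refl; sym; trans; cong; subst)
open import Relation.Nullary using (¬?)
open import Relation.Unary using (Pred; Decidable; _⊆_)

∨-monoˡ-≤ : ∀ {a b} c → a Bool.≤ b → (a ∨ c) Bool.≤ (b ∨ c)
∨-monoˡ-≤ c Bool.f≤t = Bool.≤-maximum c
∨-monoˡ-≤ c Bool.b≤b = Bool.b≤b

/-monoˡ-≤ : ∀ {i j : ℤ} d .{{_ : NonZero d}} → i ℤ.≤ j → i / d ≤ j / d
/-monoˡ-≤ {i} {j} d@(suc d-1) i≤j = toℚᵘ-cancel-≤ (begin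
  toℚᵘ (i / d) ≃⟨ toℚᵘ-fromℚᵘ (mkℚᵘ i d-1) ⟩
  mkℚᵘ i d-1   ≤⟨ *≤* (ℤ.*-monoʳ-≤-nonNeg (+ d) i≤j) ⟩
  mkℚᵘ j d-1   ≃⟨ toℚᵘ-fromℚᵘ (mkℚᵘ j d-1) ⟨
  toℚᵘ (j / d) ∎)
  where open ℚᵘ.≤-Reasoning

Pr-mono : ∀ {n p q} {P : Pred (Vec Bool n) p} {Q : Pred (Vec Bool n) q}
          (P? : Decidable P) (Q? : Decidable Q) → P ⊆ Q → Pr P? ≤ Pr Q?
Pr-mono {n} P? Q? P⊆Q = /-monoˡ-≤ (2 ^ n)
  (ℤ.+≤+ (length-mono-≤ (filter⁺ P? Q? (λ { refl → P⊆Q }) (⊆-refl {x = cube n}))))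
  where instance _ = m^n≢0 2 n

Pr-∨ᶠ-≤ : ∀ {n} {f g h : BoolFun n} → f ≗ (g ∨ᶠ h) →
          ∀ g′ → Pr[ g′ ∨ᶠ h ≢ f ] ≤ Pr[ g′ ≢ g ]
Pr-∨ᶠ-≤ {f = f} {g} {h} f≗g∨h g′ =
  Pr-mono (λ x → ¬? ((g′ ∨ᶠ h) x Bool.≟ f x)) (λ x → ¬? (g′ x Bool.≟ g x))
    λ {x} ≢f g′≡g → ≢f (trans (cong (_∨ h x) g′≡g) (sym (f≗g∨h x)))

lemma2p6 : ∀ (n : ℕ) (ε : ℝ) (f g h : BoolFun n) → f ≗ (g ∨ᶠ h) →
    ∀ (gℓ gᵤ : BoolFun n) → Sandwiching ε gℓ gᵤ g →
    Sandwiching ε (gℓ ∨ᶠ h) (gᵤ ∨ᶠ h) f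
lemma2p6 n ε f g h f≗g∨h gℓ gᵤ s = record
  { lower       = λ x → subst (_ Bool.≤_) (sym (f≗g∨h x)) (∨-monoˡ-≤ (h x) (lower x))
  ; upper       = λ x → subst (Bool._≤ _) (sym (f≗g∨h x)) (∨-monoˡ-≤ (h x) (upper x))
  ; lower-error = λ q q<p → lower-error q (<-≤-trans q<p (Pr-∨ᶠ-≤ f≗g∨h gℓ))
  ; upper-error = λ q q<p → upper-error q (<-≤-trans q<p (Pr-∨ᶠ-≤ f≗g∨h gᵤ))
  }
  where open Sandwiching s
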